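{- For every $a \in \mathbb{N}$ and every integer $b \ge 2$, $R_\mathrm{ord}(S_a^\mathrm{sc}, C_b^\mathrm{mon}) = 1 + (a-1)(b-1)$.
   Context: All graphs are finite, simple and undirected, and a graph of order $n$ has vertex set $\{0,1,\ldots,n-1\}$; $K_n$ is the complete graph on $\{0,\ldots,n-1\}$. A $2$-edge-coloring of $K_n$ assigns each edge a color in $\{1,2\}$. For a graph $H$ and such a coloring, an embedding of $H$ in color $j$ is an injective map $\varphi\colon V(H)\to V(K_n)$ such that for every edge $uv$ of $H$ the edge $\{\varphi(u),\varphi(v)\}$ has color $j$; it is increasing if $\varphi(0)<\cdots<\varphi(|H|-1)$. The ordered Ramsey number $R_\mathrm{ord}(H_1,H_2)$ is the smallest $n$ such that every $2$-edge-coloring of $K_n$ admits an increasing embedding of $H_1$ in color $1$ or an increasing embedding of $H_2$ in color $2$. The start-central star $S_n^\mathrm{sc}$ is the graph of order $n$ whose edges are exactly $\{0,v\}$ for $1\le v\le n-1$. For $n\ge3$ the monotone cycle $C_n^\mathrm{mon}$ has edges $\{i,i+1\}$ ($0\le i\le n-2$) and $\{0,n-1\}$; by convention $C_2^\mathrm{mon}=K_2$. -}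

module Defs where

open import Data.Nat.Base using (ℕ; suc; _≤_; s≤s)
open import Data.Nat.Properties using (1+n≢n)
open import Data.Fin.Base using (Fin; toℕ; _<_)
open import Data.Product.Base using (_×_; _,_; Σ-syntax)
open import Data.Sum.Base using (_⊎_; inj₁; inj₂)
open import Function.Definitions using (Injective)
open import Level using (0ℓ)
open import Relation.Binary.Core using (Rel; _Preserves_⟶_)
open import Relation.Binary.Definitions using (Symmetric; Irreflexive)
open import Relation.Binary.Construct.Closure.Symmetric using (SymClosure; fwd; bwd; symmetric)
open import Relation.Binary.PropositionalEquality.Core using (_≡_; _≢_; refl; sym; ≢-sym)

record Graph (n : ℕ) : Set₁ where
  field
    Adj    : Rel (Fin n) 0ℓ
    symm   : Symmetric Adj
    irrefl : Irreflexive _≡_ Adj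

fromEdges : ∀ {n} (E : Rel (Fin n) 0ℓ) → Irreflexive _≡_ E → Graph n
fromEdges E irr = record
  { Adj    = SymClosure E
  ; symm   = symmetric E
  ; irrefl = λ { refl (fwd e) → irr refl e ; refl (bwd e) → irr refl e }
  }

K : (n : ℕ) → Graph n
K n = record { Adj = _≢_ ; symm = ≢-sym ; irrefl = λ u≡v u≢v → u≢v u≡v }

data Color : Set where
  color₁ color₂ : Color

-- A 2-edge-coloring of K n.  The values on the diagonal carry no meaning: they
-- are never inspected by an embedding, which is injective on a loopless graph.
record Coloring (n : ℕ) : Set where
  field
    color     : Fin n → Fin n → Color
    color-sym : ∀ u v → color u v ≡ color v u

record IsEmbedding {k n : ℕ} (H : Graph k) (c : Coloring n) (j : Color)
                   (φ : Fin k → Fin n) : Set where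
  open Graph H
  open Coloring c
  field
    injective : Injective _≡_ _≡_ φ
    colored   : ∀ {u v} → Adj u v → color (φ u) (φ v) ≡ j

Increasing : ∀ {k n} → (Fin k → Fin n) → Set
Increasing φ = φ Preserves _<_ ⟶ _<_

HasIncreasingEmbedding : ∀ {k n} → Graph k → Coloring n → Color → Set
HasIncreasingEmbedding {k} {n} H c j =
  Σ[ φ ∈ (Fin k → Fin n) ] IsEmbedding H c j φ × Increasing φ

OrdArrows : ∀ {k l} → ℕ → Graph k → Graph l → Set
OrdArrows n H₁ H₂ = (c : Coloring n) →
  HasIncreasingEmbedding H₁ c color₁ ⊎ HasIncreasingEmbedding H₂ c color₂

-- IsOrdRamsey H₁ H₂ n says R_ord(H₁, H₂) = n, existence of the minimum included.
IsOrdRamsey : ∀ {k l} → Graph k → Graph l → ℕ → Set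
IsOrdRamsey H₁ H₂ n = OrdArrows n H₁ H₂ × (∀ m → OrdArrows m H₁ H₂ → n ≤ m)

Ssc : (n : ℕ) → Graph n
Ssc n = fromEdges (λ u v → toℕ u ≡ 0 × 1 ≤ toℕ v) irr
  where
  irr : Irreflexive _≡_ (λ (u v : Fin n) → toℕ u ≡ 0 × 1 ≤ toℕ v)
  irr {u} refl (u≡0 , 1≤u) with toℕ u
  irr refl (refl , ()) | .0

CycleEdge : ∀ n → Rel (Fin n) 0ℓ
CycleEdge n u v = toℕ v ≡ suc (toℕ u) ⊎ (toℕ u ≡ 0 × suc (toℕ v) ≡ n)

Cmon : (n : ℕ) → 2 ≤ n → Graph n
Cmon 0 ()
Cmon 1 (s≤s ())
Cmon 2 _ = K 2
Cmon n@(suc (suc (suc _))) _ = fromEdges (CycleEdge n) irr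
  where
  irr : Irreflexive _≡_ (CycleEdge n)
  irr refl (inj₁ u≡1+u) = 1+n≢n (sym u≡1+u)
  irr {u} refl (inj₂ (u≡0 , 1+u≡n)) with toℕ u
  irr refl (inj₂ (refl , ())) | .0

{-# OPTIONS --safe #-}
-- Write p = a - 1 and q = b - 1.
-- Upper bound: among 1 + q p vertices with least vertex x, either p of the others
-- are joined to x in color 1, which gives a star, or at least 1 + (q - 1) p of them
-- are joined to x in color 2, and one continues inside those.  This even produces
-- an increasing clique of order b in color 2.
-- Lower bound: cut at most q p vertices into q consecutive blocks of at most p
-- vertices, with color 1 inside the blocks and color 2 between them.  A star of
-- order 1 + p in color 1 would not fit into a block, and a monotone path of order
-- 1 + q in color 2 would meet 1 + q different blocks.
module Submission where

open import Data.Bool.Base using (if_then_else_)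
open import Data.Nat.Base using (ℕ; zero; suc; _+_; _*_; _∸_; _≤_; z≤n; s≤s; s<s⁻¹)
import Data.Nat.Base as ℕ
open import Data.Nat.Properties
open import Data.Fin.Base as Fin
  using (Fin; zero; suc; toℕ; fromℕ; inject₁; inject≤; combine; quotient; remainder; _<_)
open import Data.Fin.Induction using (<-weakInduction)
import Data.Fin.Properties as Fin
open import Data.List.Base using (List; []; _∷_; length; lookup; filter; allFin)
open import Data.List.Properties using (length-tabulate)
open import Data.List.Membership.Propositional.Properties using (∈-lookup)
open import Data.List.Relation.Binary.Sublist.Propositional
  using (_⊆_; _⊇_; []; _∷_; _∷ʳ_; minimum; ⊆-trans)
open import Data.List.Relation.Binary.Sublist.Propositional.Properties
  using (All-resp-⊆; filter-⊆)
open import Data.List.Relation.Unary.All as All using (All; []; _∷_)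
open import Data.List.Relation.Unary.All.Properties using (all-filter)
open import Data.List.Relation.Unary.AllPairs as AllPairs using (AllPairs; []; _∷_)
import Data.List.Relation.Unary.AllPairs.Properties as AllPairs
open import Data.Product.Base using (_×_; _,_; ∃-syntax)
open import Data.Sum.Base as Sum using (_⊎_; inj₁; inj₂; [_,_]′)
open import Function.Base using (id; _∘_)
open import Function.Bundles using (mk⇔)
open import Function.Definitions using (Injective)
open import Level using (Level; _⊔_)
open import Relation.Binary.Construct.Closure.Symmetric using (fwd; bwd)
open import Relation.Binary.Core using (Rel; _Preserves_⟶_)
open import Relation.Binary.Definitions using (_Respects_; tri<; tri≈; tri>)
  renaming (Decidable to Decidable₂)
open import Relation.Binary.PropositionalEquality
open import Relation.Nullary using (¬_; does; yes; no; contradiction)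
open import Relation.Nullary.Decidable using (does-⇔)
open import Relation.Unary using (Pred; Decidable)
open import Relation.Unary.Properties using (∁?)
open import Defs

private
  variable
    a ℓ : Level
    A : Set a
    k m n p q : ℕ

AllPairs-resp-⊆ : {R : Rel A ℓ} → (AllPairs R) Respects _⊇_
AllPairs-resp-⊆ []         []         = []
AllPairs-resp-⊆ (_ ∷ʳ τ)   (_ ∷ Rxs)  = AllPairs-resp-⊆ τ Rxs
AllPairs-resp-⊆ (refl ∷ τ) (Rx ∷ Rxs) = All-resp-⊆ τ Rx ∷ AllPairs-resp-⊆ τ Rxs

AllPairs-lookup : {R : Rel A ℓ} {xs : List A} → AllPairs R xs →
                  ∀ {i j} → i < j → R (lookup xs i) (lookup xs j)
AllPairs-lookup (Rx ∷ _)  {zero}  {suc j} _   = All.lookup Rx (∈-lookup j)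
AllPairs-lookup (_ ∷ Rxs) {suc i} {suc j} i<j = AllPairs-lookup Rxs (s<s⁻¹ i<j)

length-filter-∁ : {P : Pred A ℓ} (P? : Decidable P) (xs : List A) →
                  length (filter P? xs) + length (filter (∁? P?) xs) ≡ length xs
length-filter-∁ P? []       = refl
length-filter-∁ P? (x ∷ xs) with P? x
... | yes _ = cong suc (length-filter-∁ P? xs)
... | no  _ = trans (+-suc _ _) (cong suc (length-filter-∁ P? xs))

module _ {A : Set a} (R : Rel A ℓ) where

  StarIn : ℕ → List A → Set (a ⊔ ℓ)
  StarIn p xs = ∃[ x ] ∃[ ys ] p ≤ length ys × x ∷ ys ⊆ xs × All (R x) ys

  IndependentIn : ℕ → List A → Set (a ⊔ ℓ)
  IndependentIn q xs = ∃[ ys ] q ≤ length ys × ys ⊆ xs × AllPairs (λ x y → ¬ R x y) ys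

star-or-independent : {R : Rel A ℓ} → Decidable₂ R → ∀ p q (xs : List A) →
                      q * p ℕ.< length xs → StarIn R p xs ⊎ IndependentIn R (suc q) xs
star-or-independent R? p zero (x ∷ xs) _ =
  inj₂ (x ∷ [] , ≤-refl , refl ∷ minimum xs , [] ∷ [])
star-or-independent {A = A} {R = R} R? p (suc q) (x ∷ xs) (s≤s large)
  with p ≤? length (filter (R? x) xs)
... | yes p≤ = inj₁ (x , filter (R? x) xs , p≤ , refl ∷ filter-⊆ (R? x) xs , all-filter (R? x) xs)
... | no  p≰ = Sum.map weaken extend (star-or-independent R? p q rest rest-large)
  where
  neighbours rest : List A
  neighbours = filter (R? x) xs
  rest       = filter (∁? (R? x)) xs

  rest⊆xs : rest ⊆ xs
  rest⊆xs = filter-⊆ (∁? (R? x)) xs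

  rest-large : q * p ℕ.< length rest
  rest-large = +-cancelˡ-≤ (length neighbours) _ _ (begin
    length neighbours + suc (q * p)   ≡⟨ +-suc _ (q * p) ⟩
    suc (length neighbours) + q * p   ≤⟨ +-monoˡ-≤ (q * p) (≰⇒> p≰) ⟩
    p + q * p                         ≤⟨ large ⟩
    length xs                         ≡⟨ length-filter-∁ (R? x) xs ⟨
    length neighbours + length rest   ∎)
    where open ≤-Reasoning

  weaken : StarIn R p rest → StarIn R p (x ∷ xs)
  weaken (y , ys , p≤ , ⊆rest , star) = y , ys , p≤ , x ∷ʳ ⊆-trans ⊆rest rest⊆xs , star

  extend : IndependentIn R (suc q) rest → IndependentIn R (suc (suc q)) (x ∷ xs)
  extend (ys , q< , ⊆rest , indep) =
    x ∷ ys , s≤s q< , refl ∷ ⊆-trans ⊆rest rest⊆xs ,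
    All-resp-⊆ ⊆rest (all-filter (∁? (R? x)) xs) ∷ indep

inject≤-preserves : (R : Rel ℕ ℓ) (k≤n : k ≤ n) {i j : Fin k} → R (toℕ i) (toℕ j) →
                    R (toℕ (inject≤ i k≤n)) (toℕ (inject≤ j k≤n))
inject≤-preserves R k≤n {i} {j} =
  subst₂ R (sym (Fin.toℕ-inject≤ i k≤n)) (sym (Fin.toℕ-inject≤ j k≤n))

initial : (xs : List A) → k ≤ length xs → Fin k → A
initial xs k≤ i = lookup xs (inject≤ i k≤)

AllPairs-initial : {R : Rel A ℓ} {xs : List A} (k≤ : k ≤ length xs) → AllPairs R xs →
                   ∀ {i j} → i < j → R (initial xs k≤ i) (initial xs k≤ j)
AllPairs-initial k≤ Rxs i<j = AllPairs-lookup Rxs (inject≤-preserves ℕ._<_ k≤ i<j)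

increasing⇒injective : {φ : Fin k → Fin n} → Increasing φ → Injective _≡_ _≡_ φ
increasing⇒injective φ-inc {u} {v} φu≡φv with Fin.<-cmp u v
... | tri< u<v _ _ = contradiction φu≡φv (Fin.<⇒≢ (φ-inc u<v))
... | tri≈ _ u≡v _ = u≡v
... | tri> _ _ v<u = contradiction (sym φu≡φv) (Fin.<⇒≢ (φ-inc v<u))

toℕ≤increasing : (f : Fin (suc k) → ℕ) → (∀ i → f (inject₁ i) ℕ.< f (suc i)) →
                 ∀ i → toℕ i ≤ f i
toℕ≤increasing f f< = <-weakInduction (λ i → toℕ i ≤ f i) z≤n λ i i≤fi →
  ≤-<-trans (subst (_≤ f (inject₁ i)) (Fin.toℕ-inject₁ i) i≤fi) (f< i)

quotient-mono-≤ : ∀ m n → quotient {m} n Preserves Fin._≤_ ⟶ Fin._≤_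
quotient-mono-≤ m n {i} {j} i≤j = ≮⇒≥ λ qj<qi →
  ≤⇒≯ i≤j (subst₂ _<_ (Fin.combine-remQuot {m} n j) (Fin.combine-remQuot {m} n i)
    (Fin.combine-monoˡ-< (remainder {m} n j) (remainder {m} n i) qj<qi))

quotient-remainder-injective : ∀ m n {i j : Fin (m * n)} → quotient {m} n i ≡ quotient n j →
                               remainder {m} n i ≡ remainder {m} n j → i ≡ j
quotient-remainder-injective m n {i} {j} q≡ r≡ = begin
  i                                              ≡⟨ Fin.combine-remQuot {m} n i ⟨
  combine (quotient {m} n i) (remainder {m} n i) ≡⟨ cong₂ combine q≡ r≡ ⟩
  combine (quotient {m} n j) (remainder {m} n j) ≡⟨ Fin.combine-remQuot {m} n j ⟩
  j                                              ∎
  where open ≡-Reasoning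

≡color₁? : Decidable (_≡ color₁)
≡color₁? color₁ = yes refl
≡color₁? color₂ = no λ ()

≢color₁⇒≡color₂ : ∀ {j} → j ≢ color₁ → j ≡ color₂
≢color₁⇒≡color₂ {color₁} j≢₁ = contradiction refl j≢₁
≢color₁⇒≡color₂ {color₂} _   = refl

module _ (c : Coloring n) where
  open Coloring c

  increasing-embedding : (H : Graph k) {j : Color} (φ : Fin k → Fin n) → Increasing φ →
                         (∀ {u v} → u < v → Graph.Adj H u v → color (φ u) (φ v) ≡ j) →
                         HasIncreasingEmbedding H c j
  increasing-embedding H {j} φ φ-inc φ-col =
    φ , record { injective = increasing⇒injective φ-inc ; colored = colored } , φ-inc
    where
    open Graph H
    colored : ∀ {u v} → Adj u v → color (φ u) (φ v) ≡ j
    colored {u} {v} uv with Fin.<-cmp u v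
    ... | tri< u<v _ _ = φ-col u<v uv
    ... | tri≈ _ u≡v _ = contradiction uv (irrefl u≡v)
    ... | tri> _ _ v<u = trans (color-sym (φ u) (φ v)) (φ-col v<u (symm uv))

  clique-embedding : ∀ {j xs} (H : Graph k) → k ≤ length xs → AllPairs _<_ xs →
                     AllPairs (λ u v → color u v ≡ j) xs → HasIncreasingEmbedding H c j
  clique-embedding {xs = xs} H k≤ sorted clique = increasing-embedding H (initial xs k≤)
    (AllPairs-initial k≤ sorted) (λ u<v _ → AllPairs-initial k≤ clique u<v)

  star-embedding : ∀ {j x ys} → p ≤ length ys → AllPairs _<_ (x ∷ ys) →
                   All (λ y → color x y ≡ j) ys → HasIncreasingEmbedding (Ssc (suc p)) c j
  star-embedding {p} {j} {x} {ys} p≤ sorted joined =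
    increasing-embedding (Ssc (suc p)) φ (AllPairs-initial (s≤s p≤) sorted) colored
    where
    φ : Fin (suc p) → Fin n
    φ = initial (x ∷ ys) (s≤s p≤)

    colored : ∀ {u v} → u < v → Graph.Adj (Ssc (suc p)) u v → color (φ u) (φ v) ≡ j
    colored {zero}  {suc v} _ _ = All.lookup joined (∈-lookup (inject≤ v p≤))
    colored {suc _} {suc _} _ (fwd (() , _))
    colored {suc _} {suc _} _ (bwd (() , _))

Ssc-arrows : ∀ p q (H : Graph (suc q)) → OrdArrows (suc (q * p)) (Ssc (suc p)) H
Ssc-arrows p q H c = Sum.map
  (λ (_ , _ , p≤ , ⊆V , star) → star-embedding c p≤ (AllPairs-resp-⊆ ⊆V V-sorted) star)
  (λ (_ , q< , ⊆V , indep) → clique-embedding c H q< (AllPairs-resp-⊆ ⊆V V-sorted)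
    (AllPairs.map ≢color₁⇒≡color₂ indep))
  (star-or-independent (λ u v → ≡color₁? (color u v)) p q V
    (≤-reflexive (sym (length-tabulate id))))
  where
  open Coloring c
  V : List (Fin (suc (q * p)))
  V = allFin _

  V-sorted : AllPairs _<_ V
  V-sorted = AllPairs.tabulate⁺-< id

HasMonotonePath : Graph (suc q) → Set
HasMonotonePath H = ∀ i → Graph.Adj H (inject₁ i) (suc i)

module _ (f : Fin m → Fin q) where

  fibreColoring : Coloring m
  fibreColoring = record
    { color     = λ u v → if does (f u Fin.≟ f v) then color₁ else color₂
    ; color-sym = λ u v → cong (if_then color₁ else color₂)
                               (does-⇔ (mk⇔ sym sym) (f u Fin.≟ f v) (f v Fin.≟ f u))
    }

  open Coloring fibreColoring

  color₁⇒same-fibre : ∀ u v → color u v ≡ color₁ → f u ≡ f v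
  color₁⇒same-fibre u v _ with f u Fin.≟ f v
  ... | yes fu≡fv = fu≡fv

  color₂⇒different-fibres : ∀ u v → color u v ≡ color₂ → f u ≢ f v
  color₂⇒different-fibres u v _ with f u Fin.≟ f v
  ... | no fu≢fv = fu≢fv

  ¬star-in-fibre : (g : Fin m → Fin p) → (∀ {u v} → f u ≡ f v → g u ≡ g v → u ≡ v) →
                   ¬ HasIncreasingEmbedding (Ssc (suc p)) fibreColoring color₁
  ¬star-in-fibre {p} g f,g-injective (φ , emb , _) =
    Fin.<⇒notInjective {f = g ∘ φ} (n<1+n p) λ {u} {v} g≡ →
      injective (f,g-injective (trans (sym (same-fibre u)) (same-fibre v)) g≡)
    where
    open IsEmbedding emb
    same-fibre : ∀ v → f (φ zero) ≡ f (φ v)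
    same-fibre zero    = refl
    same-fibre (suc v) = color₁⇒same-fibre _ _ (colored (fwd (refl , s≤s z≤n)))

  ¬monotonePath-across-fibres : f Preserves Fin._≤_ ⟶ Fin._≤_ →
                                {H : Graph (suc q)} → HasMonotonePath H →
                                ¬ HasIncreasingEmbedding H fibreColoring color₂
  ¬monotonePath-across-fibres f-mono path (φ , emb , φ-inc) = <-irrefl refl (begin-strict
    q                     ≡⟨ Fin.toℕ-fromℕ q ⟨
    toℕ (fromℕ q)         ≤⟨ toℕ≤increasing (toℕ ∘ f ∘ φ) fibre< (fromℕ q) ⟩
    toℕ (f (φ (fromℕ q))) <⟨ Fin.toℕ<n _ ⟩
    q                     ∎)
    where
    open ≤-Reasoning
    open IsEmbedding emb
    fibre< : ∀ i → f (φ (inject₁ i)) < f (φ (suc i))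
    fibre< i = Fin.≤∧≢⇒< (f-mono (<⇒≤ (φ-inc (Fin.≤̄⇒inject₁< ≤-refl))))
                         (color₂⇒different-fibres _ _ (colored (path i)))

¬Ssc-arrows : {H : Graph (suc q)} → HasMonotonePath H → m ≤ q * p →
              ¬ OrdArrows m (Ssc (suc p)) H
¬Ssc-arrows {q} {m} {p} path m≤ arrows =
  [ ¬star-in-fibre block offset block,offset-injective
  , ¬monotonePath-across-fibres block block-mono path
  ]′ (arrows (fibreColoring block))
  where
  position : Fin m → Fin (q * p)
  position u = inject≤ u m≤

  block : Fin m → Fin q
  block = quotient {q} p ∘ position

  offset : Fin m → Fin p
  offset = remainder {q} p ∘ position

  block,offset-injective : ∀ {u v} → block u ≡ block v → offset u ≡ offset v → u ≡ v
  block,offset-injective {u} {v} b≡ o≡ =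
    Fin.inject≤-injective m≤ m≤ u v (quotient-remainder-injective q p b≡ o≡)

  block-mono : block Preserves Fin._≤_ ⟶ Fin._≤_
  block-mono u≤v = quotient-mono-≤ q p (inject≤-preserves _≤_ m≤ u≤v)

ordRamsey-Ssc : ∀ p (H : Graph (suc q)) → HasMonotonePath H →
                IsOrdRamsey (Ssc (suc p)) H (suc (q * p))
ordRamsey-Ssc {q} p H path =
  Ssc-arrows p q H , λ m arrows → ≰⇒> λ m≤ → ¬Ssc-arrows path m≤ arrows

Cmon-monotonePath : ∀ q (2≤b : 2 ≤ suc q) → HasMonotonePath (Cmon (suc q) 2≤b)
Cmon-monotonePath zero          (s≤s ())
Cmon-monotonePath (suc zero)    _ zero = λ ()
Cmon-monotonePath (suc (suc _)) _ i    = fwd (inj₁ (cong suc (sym (Fin.toℕ-inject₁ i))))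

theorem4p18 : (a b : ℕ) → 1 ≤ a → (2≤b : 2 ≤ b) →
    IsOrdRamsey (Ssc a) (Cmon b 2≤b) (1 + (a ∸ 1) * (b ∸ 1))
theorem4p18 (suc p) (suc q) _ 2≤b rewrite *-comm p q =
  ordRamsey-Ssc p (Cmon (suc q) 2≤b) (Cmon-monotonePath q 2≤b)
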